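{- Let $p\in(0,1]$ and put $a=\frac{2}{2-p}$. Consider the agent that starts at the origin $0$ of the real line at time $0$, always moves at speed $1$, and, for rounds $i=0,1,2,\dots$ until the target is found, moves in round $i$ from $0$ to the point $(-1)^{i+1}a^{i}$ and back to $0$. The expected competitive ratio of this algorithm is $$\frac{8}{p}+\frac{p}{2-p}.$$
   Context: Search model (the case where there is no slow speed, $v=0$): a stationary target is located at an unknown point $x$ of the real line with $|x|\ge 1$. The agent moves at speed $1$. Each time the agent passes through the location of the target it detects the target with probability $p$, independently of all other passes. In a round in which the target's location is reached, the agent passes it twice, once moving away from the origin and once on the way back (a target located exactly at the turning point of a round is also counted as passed twice in that round, both at the turning time). The search ends at the first detection; let $\tau(x)$ denote the (random) time of that detection. An omniscient agent needs time $|x|$ to reach the target. The expected competitive ratio of the algorithm is $$\sup_{|x|\ge 1}\frac{\mathbb{E}[\tau(x)]}{|x|}.$$ -}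

module Defs where

open import Algebra.Bundles using (CommutativeRing)
import Algebra.Properties.Semiring.Mult as Mult
open import Algebra.Structures using (IsCommutativeRing)
open import Data.Bool.Base using (Bool; true; false; if_then_else_; not; _∧_)
open import Data.Nat.Base as ℕ using (ℕ; zero; suc)
open import Data.Product.Base using (∃; ∃-syntax; _×_)
open import Data.Sum.Base using (_⊎_)
open import Data.Vec.Base using (Vec; []; _∷_)
open import Level using (0ℓ)
open import Relation.Binary.Core using (Rel)
open import Relation.Binary.Structures using (IsDecTotalOrder)
import Relation.Binary.Construct.NonStrictToStrict as NonStrictToStrict
open import Relation.Nullary.Decidable.Core using (Dec; ⌊_⌋; _×-dec_; _⊎-dec_)
open import Relation.Nullary.Negation.Core using (¬_)
open import Relation.Unary using (Pred; Satisfiable)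

module _ {A : Set} (_≤_ : Rel A 0ℓ) where

  IsUpperBound : Pred A 0ℓ → A → Set
  IsUpperBound P b = ∀ y → P y → y ≤ b

  IsSupremum : Pred A 0ℓ → A → Set
  IsSupremum P s = IsUpperBound P s × (∀ b → IsUpperBound P b → s ≤ b)

-- The classical real line, axiomatised up to isomorphism as a complete
-- ordered field with decidable order.  Classically _⁻¹ can be made total (its
-- value at 0# is left unspecified) and archimedean follows from completeness;
-- it is a field of its own because completeness alone does not constructively
-- produce the natural number.

record CompleteOrderedField : Set₁ where
  infix  4 _≈_ _≤_
  infixl 6 _+_
  infixl 7 _*_
  infix  8 -_
  infix  9 _⁻¹
  field
    Carrier           : Set
    _≈_               : Rel Carrier 0ℓ
    _≤_               : Rel Carrier 0ℓ
    _+_ _*_           : Carrier → Carrier → Carrier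
    -_ _⁻¹            : Carrier → Carrier
    0# 1#             : Carrier
    isCommutativeRing : IsCommutativeRing _≈_ _+_ _*_ -_ 0# 1#
    1≉0               : ¬ (1# ≈ 0#)
    *-inverseʳ        : ∀ x → ¬ (x ≈ 0#) → x * x ⁻¹ ≈ 1#
    isDecTotalOrder   : IsDecTotalOrder _≈_ _≤_
    +-monoˡ-≤         : ∀ z {x y} → x ≤ y → x + z ≤ y + z
    *-nonNegative     : ∀ {x y} → 0# ≤ x → 0# ≤ y → 0# ≤ x * y

  commutativeRing : CommutativeRing 0ℓ 0ℓ
  commutativeRing = record { isCommutativeRing = isCommutativeRing }

  open CommutativeRing commutativeRing public
    using (_-_; semiring)
  open IsDecTotalOrder isDecTotalOrder public
    using (_≤?_)
  open NonStrictToStrict _≈_ _≤_ public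
    using (_<_)

  fromℕ : ℕ → Carrier
  fromℕ n = Mult._×_ semiring n 1#

  field
    archimedean       : ∀ x → ∃[ n ] x ≤ fromℕ n
    complete          : (P : Pred Carrier 0ℓ) → Satisfiable P →
                        ∃ (IsUpperBound _≤_ P) → ∃ (IsSupremum _≤_ P)

  open import Algebra.Properties.Semiring.Exp semiring public
    using (_^_)

  infixl 7 _/_
  _/_ : Carrier → Carrier → Carrier
  x / y = x * y ⁻¹

  ∣_∣ : Carrier → Carrier
  ∣ x ∣ = if ⌊ 0# ≤? x ⌋ then x else - x

module LinearSearch (R : CompleteOrderedField) where
  open CompleteOrderedField R renaming (Carrier to ℝ)

  partialSum : (ℕ → ℝ) → ℕ → ℝ
  partialSum f zero    = 0#
  partialSum f (suc n) = partialSum f n + f n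

  HasSum : (ℕ → ℝ) → ℝ → Set
  HasSum f s = ∀ ε → 0# < ε →
    ∃[ N ] (∀ n → N ℕ.≤ n → ∣ partialSum f n - s ∣ < ε)

  -- A unit-speed motion is given by its waypoints w: leg k is the straight
  -- segment from w k to w (suc k), and the motion starts at w 0 at time 0.

  departure : (ℕ → ℝ) → ℕ → ℝ
  departure w zero    = 0#
  departure w (suc k) = departure w k + ∣ w (suc k) - w k ∣

  -- Endpoints are included, so that a target at a turning point is passed on
  -- both adjacent legs (at the same time).
  Passes : (ℕ → ℝ) → ℝ → ℕ → Set
  Passes w x k = (w k ≤ x × x ≤ w (suc k)) ⊎ (w (suc k) ≤ x × x ≤ w k)

  passes? : ∀ w x k → Dec (Passes w x k)
  passes? w x k = ((w k ≤? x) ×-dec (x ≤? w (suc k)))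
            ⊎-dec ((w (suc k) ≤? x) ×-dec (x ≤? w k))

  passTime : (ℕ → ℝ) → ℝ → ℕ → ℝ
  passTime w x k = departure w k + ∣ x - w k ∣

  -- Round i goes from 0 to T i and back: the waypoints are 0, T 0, 0, T 1, ...
  rounds : (ℕ → ℝ) → ℕ → ℝ
  rounds T zero          = 0#
  rounds T (suc zero)    = T 0
  rounds T (suc (suc k)) = rounds (λ i → T (suc i)) k

  -- Probability of an event determined by n independent trials, each of which
  -- succeeds with probability p.
  Pr : ℝ → (n : ℕ) → (Vec Bool n → Bool) → ℝ
  Pr p zero    A = if A [] then 1# else 0#
  Pr p (suc n) A = p        * Pr p n (λ ω → A (true  ∷ ω))
                 + (1# - p) * Pr p n (λ ω → A (false ∷ ω))

  -- One trial per leg; the trial of a leg counts only if the leg passes the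
  -- target.  The event is that the first detection happens on the last of the
  -- legs 0, ..., k.
  firstDetection : (ℕ → Bool) → (k : ℕ) → Vec Bool (suc k) → Bool
  firstDetection passes zero    (c ∷ []) = passes 0 ∧ c
  firstDetection passes (suc k) (c ∷ ω)  =
    not (passes 0 ∧ c) ∧ firstDetection (λ j → passes (suc j)) k ω

  detectionProbability : ℝ → (ℕ → ℝ) → ℝ → ℕ → ℝ
  detectionProbability p w x k =
    Pr p (suc k) (firstDetection (λ j → ⌊ passes? w x j ⌋) k)

  -- E[τ(x)] = e, where τ(x) is passTime w x k if the first detection happens on
  -- leg k, and infinite if there is no detection; a finite expectation thus
  -- requires detection with probability 1.
  ExpectedDetectionTime : ℝ → (ℕ → ℝ) → ℝ → ℝ → Set
  ExpectedDetectionTime p w x e =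
      HasSum (detectionProbability p w x) 1#
    × HasSum (λ k → detectionProbability p w x k * passTime w x k) e

  CompetitiveRatioAt : ℝ → (ℕ → ℝ) → Pred ℝ 0ℓ
  CompetitiveRatioAt p w r =
    ∃[ x ] ∃[ e ] (1# ≤ ∣ x ∣ × ExpectedDetectionTime p w x e × r ≈ e / ∣ x ∣)

  -- The supremum is a real number only if every expectation is finite, whence
  -- the first conjunct.
  IsExpectedCompetitiveRatio : ℝ → (ℕ → ℝ) → ℝ → Set
  IsExpectedCompetitiveRatio p w c =
      (∀ x → 1# ≤ ∣ x ∣ → ∃[ e ] ExpectedDetectionTime p w x e)
    × IsSupremum _≤_ (CompetitiveRatioAt p w) c

{-# OPTIONS --safe #-}

-- Write b = 2 - p, u = 1/p, q = 1 - p, so a b = 2.  For a target at distance X,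
-- let e(A) be the expected detection time at the start of a round with turning
-- distance A that reaches the still undetected target.  Only every other round
-- is on the target's side, and the recurrence for e(A) in terms of e(a² A) has
-- the affine solution e(A) = 2 b² u A + (a - 1) X - 2 b u.  The remainder after
-- k reaching rounds is q²ᵏ e(a²ᵏ A), which vanishes because q a² ≤ 1 < a.  If A
-- is the first distance to reach X, then A ≤ a² X, and e(A) / X is at most
-- 2 a² b² u + (a - 1) = 8/p + p/(2 - p).  Targets at distance X = a²ᵏ + 1 on
-- the side of the even rounds have A = a² (X - 1) and approach this bound.

module Submission where

open import Defs
open import Data.Nat.Base using (suc)

open import Algebra.Bundles using (CommutativeRing)
import Algebra.Properties.AbelianGroup as AbelianGroupProperties
import Algebra.Properties.Ring as RingProperties
open import Algebra.Properties.Semiring.Exp using (^-congˡ; ^-homo-*)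
import Algebra.Properties.Semiring.Mult as SemiringMult
import Algebra.Solver.Ring as RingSolver
open import Algebra.Solver.Ring.AlmostCommutativeRing
  using (fromCommutativeRing; _-Raw-AlmostCommutative⟶_)
open import Data.Bool.Base using (Bool; true; false; if_then_else_)
open import Data.Integer.Base as ℤ using (ℤ; +_; -[1+_]; _⊖_)
import Data.Integer.Properties as ℤ
open import Data.Maybe.Base as Maybe using (Maybe)
open import Data.Nat.Base as ℕ using (ℕ; zero; z≤n; s≤s)
import Data.Nat.Properties as ℕ
open import Data.Product.Base using (∃-syntax; _×_; _,_; proj₁; proj₂)
open import Data.Sum.Base as Sum using (_⊎_; inj₁; inj₂; [_,_]′)
open import Function.Base using (_∘_)
open import Relation.Binary.Bundles using (Poset)
open import Relation.Binary.PropositionalEquality.Core as ≡ using (_≡_)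
import Relation.Binary.Reasoning.PartialOrder as PosetReasoning
import Relation.Binary.Reasoning.Setoid as SetoidReasoning
open import Relation.Binary.Structures using (IsDecTotalOrder)
open import Relation.Nullary.Decidable.Core using (Dec; yes; no; ⌊_⌋; dec⇒maybe)
open import Relation.Nullary.Negation.Core using (¬_; contradiction)

-- Ring solver with integer coefficients over a commutative ring.

module IntegerCoefficients {c ℓ} (R : CommutativeRing c ℓ) where
  open CommutativeRing R
  open AbelianGroupProperties +-abelianGroup using (⁻¹-∙-comm; ⁻¹-involutive; ε⁻¹≈ε)
  open RingProperties ring using (-‿distribˡ-*; -‿distribʳ-*)
  open SemiringMult semiring using (×-homo-+; ×1-homo-*) renaming (_×_ to infixr 8 _·_)
  open SetoidReasoning setoid

  ⟦_⟧ : ℤ → Carrier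
  ⟦ + n ⟧      = n · 1#
  ⟦ -[1+ n ] ⟧ = - (suc n · 1#)

  ⊖-homo : ∀ m n → ⟦ m ⊖ n ⟧ ≈ m · 1# - n · 1#
  ⊖-homo zero    zero    = sym (-‿inverseʳ 0#)
  ⊖-homo zero    (suc n) = sym (+-identityˡ _)
  ⊖-homo (suc m) zero    = sym (trans (+-congˡ ε⁻¹≈ε) (+-identityʳ _))
  ⊖-homo (suc m) (suc n) = begin
    ⟦ suc m ⊖ suc n ⟧                 ≡⟨ ≡.cong ⟦_⟧ (ℤ.[1+m]⊖[1+n]≡m⊖n m n) ⟩
    ⟦ m ⊖ n ⟧                         ≈⟨ ⊖-homo m n ⟩
    M - N                             ≈⟨ +-congʳ (+-identityʳ M) ⟨
    M + 0# - N                        ≈⟨ +-congʳ (+-congˡ (-‿inverseʳ 1#)) ⟨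
    M + (1# - 1#) - N                 ≈⟨ +-congʳ (+-assoc M 1# (- 1#)) ⟨
    M + 1# - 1# - N                   ≈⟨ +-congʳ (+-congʳ (+-comm M 1#)) ⟩
    1# + M - 1# - N                   ≈⟨ +-assoc _ _ _ ⟩
    1# + M + (- 1# - N)               ≈⟨ +-congˡ (⁻¹-∙-comm 1# N) ⟩
    1# + M - (1# + N)                 ∎
    where M = m · 1#; N = n · 1#

  +-homo : ∀ i j → ⟦ i ℤ.+ j ⟧ ≈ ⟦ i ⟧ + ⟦ j ⟧
  +-homo (+ m)      (+ n)      = ×-homo-+ 1# m n
  +-homo (+ m)      -[1+ n ]   = ⊖-homo m (suc n)
  +-homo -[1+ m ]   (+ n)      = trans (⊖-homo n (suc m)) (+-comm _ _)
  +-homo -[1+ m ]   -[1+ n ]   = begin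
    - (suc (suc (m ℕ.+ n)) · 1#)         ≈⟨ -‿cong (+-congˡ (×-homo-+ 1# (suc m) n)) ⟩
    - (1# + (suc m · 1# + n · 1#))       ≈⟨ -‿cong (+-assoc _ _ _) ⟨
    - (1# + suc m · 1# + n · 1#)         ≈⟨ -‿cong (+-congʳ (+-comm _ _)) ⟩
    - (suc m · 1# + 1# + n · 1#)         ≈⟨ -‿cong (+-assoc _ _ _) ⟩
    - (suc m · 1# + suc n · 1#)          ≈⟨ ⁻¹-∙-comm _ _ ⟨
    - (suc m · 1#) - suc n · 1#          ∎

  -‿homo : ∀ i → ⟦ ℤ.- i ⟧ ≈ - ⟦ i ⟧
  -‿homo (+ zero)   = sym ε⁻¹≈ε
  -‿homo (+ suc n)  = refl
  -‿homo -[1+ n ]   = sym (⁻¹-involutive _)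

  +*-homo : ∀ m j → ⟦ + m ℤ.* j ⟧ ≈ m · 1# * ⟦ j ⟧
  +*-homo m (+ n)    = begin
    ⟦ + m ℤ.* + n ⟧        ≡⟨ ≡.cong ⟦_⟧ (ℤ.pos-* m n) ⟨
    (m ℕ.* n) · 1#         ≈⟨ ×1-homo-* m n ⟩
    m · 1# * n · 1#        ∎
  +*-homo m -[1+ n ] = begin
    ⟦ + m ℤ.* -[1+ n ] ⟧         ≡⟨ ≡.cong ⟦_⟧ (ℤ.neg-distribʳ-* (+ m) (+ suc n)) ⟨
    ⟦ ℤ.- (+ m ℤ.* + suc n) ⟧    ≈⟨ -‿homo (+ m ℤ.* + suc n) ⟩
    - ⟦ + m ℤ.* + suc n ⟧        ≈⟨ -‿cong (+*-homo m (+ suc n)) ⟩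
    - (m · 1# * suc n · 1#)      ≈⟨ -‿distribʳ-* _ _ ⟩
    m · 1# * - (suc n · 1#)      ∎

  *-homo : ∀ i j → ⟦ i ℤ.* j ⟧ ≈ ⟦ i ⟧ * ⟦ j ⟧
  *-homo (+ m)    j = +*-homo m j
  *-homo -[1+ m ] j = begin
    ⟦ -[1+ m ] ℤ.* j ⟧          ≡⟨ ≡.cong ⟦_⟧ (ℤ.neg-distribˡ-* (+ suc m) j) ⟨
    ⟦ ℤ.- (+ suc m ℤ.* j) ⟧     ≈⟨ -‿homo (+ suc m ℤ.* j) ⟩
    - ⟦ + suc m ℤ.* j ⟧         ≈⟨ -‿cong (+*-homo (suc m) j) ⟩
    - (suc m · 1# * ⟦ j ⟧)      ≈⟨ -‿distribˡ-* _ _ ⟩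
    - (suc m · 1#) * ⟦ j ⟧      ∎

  morphism : ℤ.+-*-rawRing -Raw-AlmostCommutative⟶ fromCommutativeRing R
  morphism = record
    { ⟦_⟧    = ⟦_⟧
    ; +-homo = +-homo
    ; *-homo = *-homo
    ; -‿homo = -‿homo
    ; 0-homo = refl
    ; 1-homo = +-identityʳ 1#
    }

  -- Comparing the integers themselves is sound in every commutative ring, and the solver needs only
  -- positive answers.
  _coeff≟_ : ∀ i j → Maybe (⟦ i ⟧ ≈ ⟦ j ⟧)
  i coeff≟ j = Maybe.map (λ i≡j → reflexive (≡.cong ⟦_⟧ i≡j)) (dec⇒maybe (i ℤ.≟ j))

  open RingSolver ℤ.+-*-rawRing (fromCommutativeRing R) morphism _coeff≟_ public
    using (solve; _:=_; _:+_; _:*_; _:-_; :-_; _:^_; con; Polynomial)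

  -- con (+ 1) denotes 1# + 0#, whereas one denotes 1# itself.
  one : ∀ {n} → Polynomial n
  one = con (+ 1) :^ 0

-- Arithmetic of ordered fields, growth of powers, absolute value.

module OrderedField (R : CompleteOrderedField) where
  open CompleteOrderedField R public
  open CommutativeRing commutativeRing public
    using (setoid; refl; sym; trans; reflexive; +-cong; +-congˡ; +-congʳ; *-cong; *-congˡ; *-congʳ;
           -‿cong; +-identityˡ; +-identityʳ; *-identityˡ; *-identityʳ; zeroˡ; +-comm; *-comm;
           +-assoc; *-assoc; -‿inverseʳ)
  open IsDecTotalOrder isDecTotalOrder public
    using (isPartialOrder; antisym; total)
    renaming (refl to ≤-refl; trans to ≤-trans; reflexive to ≤-reflexive)
  open IntegerCoefficients commutativeRing public
    using (solve; _:=_; _:+_; _:*_; _:-_; :-_; _:^_; con; one)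

  poset : Poset _ _ _
  poset = record { isPartialOrder = isPartialOrder }

  open PosetReasoning poset public using (begin_; _∎; step-≤; step-≈-⟩; step-≈-⟨)

  -- Most inequalities below are proved by naming their difference `d` in a visibly nonnegative
  -- form, which leaves a ring identity for the solver.
  ≤-by : ∀ {x y d} → 0# ≤ d → x + d ≈ y → x ≤ y
  ≤-by {x} {y} {d} 0≤d x+d≈y = begin
    x       ≈⟨ +-identityˡ x ⟨
    0# + x  ≤⟨ +-monoˡ-≤ x 0≤d ⟩
    d + x   ≈⟨ +-comm d x ⟩
    x + d   ≈⟨ x+d≈y ⟩
    y       ∎

  x≤y⇒0≤y-x : ∀ {x y} → x ≤ y → 0# ≤ y - x
  x≤y⇒0≤y-x {x} {y} x≤y = begin
    0#     ≈⟨ -‿inverseʳ x ⟨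
    x - x  ≤⟨ +-monoˡ-≤ (- x) x≤y ⟩
    y - x  ∎

  +-mono-≤ : ∀ {x y z w} → x ≤ y → z ≤ w → x + z ≤ y + w
  +-mono-≤ {x} {y} {z} {w} x≤y z≤w = begin
    x + z  ≤⟨ +-monoˡ-≤ z x≤y ⟩
    y + z  ≈⟨ +-comm y z ⟩
    z + y  ≤⟨ +-monoˡ-≤ y z≤w ⟩
    w + y  ≈⟨ +-comm w y ⟩
    y + w  ∎

  +-nonNegative : ∀ {x y} → 0# ≤ x → 0# ≤ y → 0# ≤ x + y
  +-nonNegative 0≤x 0≤y = ≤-trans (≤-reflexive (sym (+-identityˡ 0#))) (+-mono-≤ 0≤x 0≤y)

  neg-mono-≤ : ∀ {x y} → x ≤ y → - y ≤ - x
  neg-mono-≤ {x} {y} x≤y =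
    ≤-by (x≤y⇒0≤y-x x≤y) (solve 2 (λ x y → :- y :+ (y :- x) := :- x) refl x y)

  neg-cancel-≤ : ∀ {x y} → - y ≤ - x → x ≤ y
  neg-cancel-≤ {x} {y} -y≤-x =
    ≤-by (x≤y⇒0≤y-x -y≤-x) (solve 2 (λ x y → x :+ (:- x :- :- y) := y) refl x y)

  *-monoˡ-≤ : ∀ {x y z} → 0# ≤ z → x ≤ y → z * x ≤ z * y
  *-monoˡ-≤ {x} {y} {z} 0≤z x≤y = ≤-by (*-nonNegative 0≤z (x≤y⇒0≤y-x x≤y))
    (solve 3 (λ x y z → z :* x :+ z :* (y :- x) := z :* y) refl x y z)

  *-monoʳ-≤ : ∀ {x y z} → 0# ≤ z → x ≤ y → x * z ≤ y * z
  *-monoʳ-≤ {x} {y} {z} 0≤z x≤y = begin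
    x * z  ≈⟨ *-comm x z ⟩
    z * x  ≤⟨ *-monoˡ-≤ 0≤z x≤y ⟩
    z * y  ≈⟨ *-comm z y ⟩
    y * z  ∎

  *-mono-≤ : ∀ {x y z w} → 0# ≤ y → 0# ≤ z → x ≤ y → z ≤ w → x * z ≤ y * w
  *-mono-≤ 0≤y 0≤z x≤y z≤w = ≤-trans (*-monoʳ-≤ 0≤z x≤y) (*-monoˡ-≤ 0≤y z≤w)

  ≰⇒> : ∀ {x y} → ¬ x ≤ y → y < x
  ≰⇒> {x} {y} x≰y with total x y
  ... | inj₁ x≤y = contradiction x≤y x≰y
  ... | inj₂ y≤x = y≤x , λ y≈x → x≰y (≤-reflexive (sym y≈x))

  ≮⇒≥ : ∀ {x y} → ¬ x < y → y ≤ x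
  ≮⇒≥ {x} {y} x≮y with y ≤? x
  ... | yes y≤x = y≤x
  ... | no  y≰x = contradiction (≰⇒> y≰x) x≮y

  <⇒≱ : ∀ {x y} → x < y → ¬ y ≤ x
  <⇒≱ (x≤y , x≉y) y≤x = x≉y (antisym x≤y y≤x)

  x<y⇒0<y-x : ∀ {x y} → x < y → 0# < y - x
  x<y⇒0<y-x {x} {y} (x≤y , x≉y) = x≤y⇒0≤y-x x≤y , λ 0≈y-x → x≉y (≈.begin
    x            ≈.≈⟨ +-identityʳ x ⟨
    x + 0#       ≈.≈⟨ +-congˡ 0≈y-x ⟩
    x + (y - x)  ≈.≈⟨ solve 2 (λ x y → x :+ (y :- x) := y) refl x y ⟩
    y            ≈.∎)
    where module ≈ = SetoidReasoning setoid

  0≤1 : 0# ≤ 1#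
  0≤1 with total 0# 1#
  ... | inj₁ 0≤1 = 0≤1
  -- In this case `- 1#` is nonnegative, hence so is its square, which is `1#`.
  ... | inj₂ 1≤0 = begin
    0#           ≤⟨ *-nonNegative 0≤-1 0≤-1 ⟩
    - 1# * - 1#  ≈⟨ solve 0 (:- one :* :- one := one) refl ⟩
    1#           ∎
    where
    0≤-1 : 0# ≤ - 1#
    0≤-1 = ≤-trans (≤-reflexive (solve 0 (con (+ 0) := :- con (+ 0)) refl)) (neg-mono-≤ 1≤0)

  0<1 : 0# < 1#
  0<1 = 0≤1 , λ 0≈1 → 1≉0 (sym 0≈1)

  fromℕ-nonNegative : ∀ n → 0# ≤ fromℕ n
  fromℕ-nonNegative zero    = ≤-refl
  fromℕ-nonNegative (suc n) = +-nonNegative 0≤1 (fromℕ-nonNegative n)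

  <-≤-trans : ∀ {x y z} → x < y → y ≤ z → x < z
  <-≤-trans x<y y≤z = ≰⇒> λ z≤x → <⇒≱ x<y (≤-trans y≤z z≤x)

  ≤-<-trans : ∀ {x y z} → x ≤ y → y < z → x < z
  ≤-<-trans x≤y y<z = ≰⇒> λ z≤x → <⇒≱ y<z (≤-trans z≤x x≤y)

  >⇒≉0 : ∀ {x} → 0# < x → ¬ x ≈ 0#
  >⇒≉0 (_ , 0≉x) x≈0 = 0≉x (sym x≈0)

  x<x+1 : ∀ x → x < x + 1#
  x<x+1 x = ≰⇒> λ x+1≤x → <⇒≱ 0<1
    (≤-trans (≤-reflexive (solve 1 (λ x → one := x :+ one :+ :- x) refl x))
      (≤-trans (+-monoˡ-≤ (- x) x+1≤x) (≤-reflexive (-‿inverseʳ x))))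

  *-inverseˡ : ∀ {x} → 0# < x → x ⁻¹ * x ≈ 1#
  *-inverseˡ {x} 0<x = trans (*-comm _ _) (*-inverseʳ x (>⇒≉0 0<x))

  ⁻¹-positive : ∀ {x} → 0# < x → 0# < x ⁻¹
  ⁻¹-positive {x} 0<x = ≰⇒> λ x⁻¹≤0 → <⇒≱ 0<1 (begin
    1#        ≈⟨ *-inverseˡ 0<x ⟨
    x ⁻¹ * x  ≤⟨ *-monoʳ-≤ (proj₁ 0<x) x⁻¹≤0 ⟩
    0# * x    ≈⟨ zeroˡ x ⟩
    0#        ∎)

  /-cancel : ∀ {x y} → 0# < y → x / y * y ≈ x
  /-cancel {x} {y} 0<y =
    trans (*-assoc x (y ⁻¹) y) (trans (*-congˡ (*-inverseˡ 0<y)) (*-identityʳ x))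

  *-cancelʳ-≤ : ∀ {x y z} → 0# < z → x * z ≤ y * z → x ≤ y
  *-cancelʳ-≤ {x} {y} {z} 0<z xz≤yz = begin
    x             ≈⟨ lemma x ⟩
    x * z * z ⁻¹  ≤⟨ *-monoʳ-≤ (proj₁ (⁻¹-positive 0<z)) xz≤yz ⟩
    y * z * z ⁻¹  ≈⟨ lemma y ⟨
    y             ∎
    where
    lemma : ∀ w → w ≈ w * z * z ⁻¹
    lemma w = sym (trans (*-assoc w z (z ⁻¹))
      (trans (*-congˡ (*-inverseʳ z (>⇒≉0 0<z))) (*-identityʳ w)))

  /-nonNegative : ∀ {x y} → 0# ≤ x → 0# < y → 0# ≤ x / y
  /-nonNegative 0≤x 0<y = *-nonNegative 0≤x (proj₁ (⁻¹-positive 0<y))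

  ^-nonNegative : ∀ {x} → 0# ≤ x → ∀ n → 0# ≤ x ^ n
  ^-nonNegative 0≤x zero    = 0≤1
  ^-nonNegative 0≤x (suc n) = *-nonNegative 0≤x (^-nonNegative 0≤x n)

  1≤x^n : ∀ {x} → 1# ≤ x → ∀ n → 1# ≤ x ^ n
  1≤x^n         1≤x zero    = ≤-refl
  1≤x^n {x} 1≤x (suc n) = begin
    1#          ≈⟨ *-identityʳ 1# ⟨
    1# * 1#     ≤⟨ *-mono-≤ (≤-trans 0≤1 1≤x) 0≤1 1≤x (1≤x^n 1≤x n) ⟩
    x * x ^ n   ∎

  ^-monoʳ-≤ : ∀ {x} → 1# ≤ x → ∀ {m n} → m ℕ.≤ n → x ^ m ≤ x ^ n
  ^-monoʳ-≤ {x} 1≤x {n = n} z≤n = 1≤x^n 1≤x n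
  ^-monoʳ-≤ 1≤x (s≤s m≤n) = *-monoˡ-≤ (≤-trans 0≤1 1≤x) (^-monoʳ-≤ 1≤x m≤n)

  bernoulli : ∀ {h} → 0# ≤ h → ∀ n → 1# + fromℕ n * h ≤ (1# + h) ^ n
  bernoulli {h} 0≤h zero    = ≤-reflexive (solve 1 (λ h → one :+ con (+ 0) :* h := one) refl h)
  bernoulli {h} 0≤h (suc n) = begin
    1# + (1# + fromℕ n) * h
      -- The term given away is `fromℕ n * (h * h)`.
      ≤⟨ ≤-by (*-nonNegative (fromℕ-nonNegative n) (*-nonNegative 0≤h 0≤h))
      (solve 2 (λ h N → one :+ (one :+ N) :* h :+ N :* (h :* h) := (one :+ h) :* (one :+ N :* h))
        refl h (fromℕ n)) ⟩
    (1# + h) * (1# + fromℕ n * h) ≤⟨ *-monoˡ-≤ (+-nonNegative 0≤1 0≤h) (bernoulli 0≤h n) ⟩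
    (1# + h) ^ suc n              ∎

  -- With `h = x - 1#`, Bernoulli's inequality bounds the power below by linear growth of slope `h`,
  -- and the Archimedean property supplies an `n` above `y / h`.
  ^-unbounded : ∀ {x} → 1# < x → ∀ y → ∃[ n ] y < x ^ n
  ^-unbounded {x} 1<x y = n , <-≤-trans (x<x+1 y) (begin
    y + 1#                 ≈⟨ +-congʳ (/-cancel 0<h) ⟨
    y / h * h + 1#         ≤⟨ +-monoˡ-≤ 1# (*-monoʳ-≤ (proj₁ 0<h) y/h≤n) ⟩
    fromℕ n * h + 1#       ≈⟨ +-comm _ _ ⟩
    1# + fromℕ n * h       ≤⟨ bernoulli (proj₁ 0<h) n ⟩
    (1# + h) ^ n           ≈⟨ ^-congˡ semiring n (solve 1 (λ x → one :+ (x :- one) := x) refl x) ⟩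
    x ^ n                  ∎)
    where
    h = x - 1#
    0<h = x<y⇒0<y-x 1<x
    n = proj₁ (archimedean (y / h))
    y/h≤n = proj₂ (archimedean (y / h))

  ∣∣-nonNegative : ∀ {x} → 0# ≤ x → ∣ x ∣ ≈ x
  ∣∣-nonNegative {x} 0≤x with 0# ≤? x
  ... | yes _   = refl
  ... | no  0≰x = contradiction 0≤x 0≰x

  ∣∣-nonPositive : ∀ {x} → x ≤ 0# → ∣ x ∣ ≈ - x
  ∣∣-nonPositive {x} x≤0 with 0# ≤? x
  ... | no  _   = refl
  ... | yes 0≤x = trans x≈0 (trans (solve 0 (con (+ 0) := :- con (+ 0)) refl) (-‿cong (sym x≈0)))
    where x≈0 = antisym x≤0 0≤x

  ∣∣-unique : ∀ {x y} → 0# ≤ y → x ≈ y ⊎ x ≈ - y → ∣ x ∣ ≈ y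
  ∣∣-unique 0≤y (inj₁ x≈y) =
    trans (∣∣-nonNegative (≤-trans 0≤y (≤-reflexive (sym x≈y)))) x≈y
  ∣∣-unique {x} {y} 0≤y (inj₂ x≈-y) = trans (∣∣-nonPositive x≤0)
    (trans (-‿cong x≈-y) (solve 1 (λ y → :- :- y := y) refl y))
    where
    x≤0 : x ≤ 0#
    x≤0 = begin
      x     ≈⟨ x≈-y ⟩
      - y   ≤⟨ neg-mono-≤ 0≤y ⟩
      - 0#  ≈⟨ solve 0 (:- con (+ 0) := con (+ 0)) refl ⟩
      0#    ∎

  0≤∣x∣ : ∀ x → 0# ≤ ∣ x ∣
  0≤∣x∣ x with 0# ≤? x
  ... | yes 0≤x = 0≤x
  ... | no  0≰x = ≤-trans (≤-reflexive (solve 0 (con (+ 0) := :- con (+ 0)) refl))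
                    (neg-mono-≤ (proj₁ (≰⇒> 0≰x)))

  ∣∣-sign : ∀ x → x ≈ ∣ x ∣ ⊎ x ≈ - ∣ x ∣
  ∣∣-sign x with 0# ≤? x
  ... | yes _ = inj₁ refl
  ... | no  _ = inj₂ (solve 1 (λ x → x := :- :- x) refl x)

  -- The absolute value branches on a decision about its argument, so congruence is not automatic;
  -- the sign of `y` is carried over to `x`.
  ∣∣-cong : ∀ {x y} → x ≈ y → ∣ x ∣ ≈ ∣ y ∣
  ∣∣-cong {x} {y} x≈y with ∣∣-sign y
  ... | inj₁ y≈∣y∣  = ∣∣-unique (0≤∣x∣ y) (inj₁ (trans x≈y y≈∣y∣))
  ... | inj₂ y≈-∣y∣ = ∣∣-unique (0≤∣x∣ y) (inj₂ (trans x≈y y≈-∣y∣))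

  x≤∣x∣ : ∀ x → x ≤ ∣ x ∣
  x≤∣x∣ x with total 0# x
  ... | inj₁ 0≤x = ≤-reflexive (sym (∣∣-nonNegative 0≤x))
  ... | inj₂ x≤0 = ≤-trans x≤0 (0≤∣x∣ x)

  -x≤∣x∣ : ∀ x → - x ≤ ∣ x ∣
  -x≤∣x∣ x = ≤-trans (x≤∣x∣ (- x)) (≤-reflexive (∣∣-unique (0≤∣x∣ x) (flip (∣∣-sign x))))
    where
    flip : x ≈ ∣ x ∣ ⊎ x ≈ - ∣ x ∣ → - x ≈ ∣ x ∣ ⊎ - x ≈ - ∣ x ∣
    flip (inj₁ e) = inj₂ (-‿cong e)
    flip (inj₂ e) = inj₁ (trans (-‿cong e) (solve 1 (λ y → :- :- y := y) refl ∣ x ∣))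

-- Series with nonnegative terms.

module Series (R : CompleteOrderedField) where
  open OrderedField R
  open LinearSearch R

  partialSum-cong : ∀ {f g} → (∀ k → f k ≈ g k) → ∀ n → partialSum f n ≈ partialSum g n
  partialSum-cong f≈g zero    = refl
  partialSum-cong f≈g (suc n) = +-cong (partialSum-cong f≈g n) (f≈g n)

  HasSum-cong : ∀ {f g s} → (∀ k → f k ≈ g k) → HasSum f s → HasSum g s
  HasSum-cong f≈g f-sum ε 0<ε with f-sum ε 0<ε
  ... | N , near = N , λ n N≤n → ≤-<-trans
    (≤-reflexive (∣∣-cong (+-congʳ (sym (partialSum-cong f≈g n))))) (near n N≤n)

  partialSum-mono-≤ : ∀ {f} → (∀ k → 0# ≤ f k) → ∀ {m n} → m ℕ.≤ n → partialSum f m ≤ partialSum f n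
  partialSum-mono-≤ {f} 0≤f {m} m≤n = go (ℕ.≤⇒≤′ m≤n)
    where
    go : ∀ {n} → m ℕ.≤′ n → partialSum f m ≤ partialSum f n
    go (ℕ.≤′-reflexive ≡.refl) = ≤-refl
    go (ℕ.≤′-step m≤′n)        = ≤-trans (go m≤′n) (≤-by (0≤f _) refl)

  -- A partial sum above `s` would keep all later ones at least as far above it, contradicting
  -- convergence with that gap as `ε`.
  partialSum≤sum : ∀ {f s} → (∀ k → 0# ≤ f k) → HasSum f s → ∀ n → partialSum f n ≤ s
  partialSum≤sum {f} {s} 0≤f f-sum n = ≮⇒≥ λ s<S →
    let N , near = f-sum (partialSum f n - s) (x<y⇒0<y-x s<S) in
    <⇒≱ (near (n ℕ.⊔ N) (ℕ.m≤n⊔m n N))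
      (≤-trans (+-monoˡ-≤ (- s) (partialSum-mono-≤ 0≤f (ℕ.m≤m⊔n n N))) (x≤∣x∣ _))

  sum≤bound : ∀ {f s b} → HasSum f s → (∀ n → partialSum f n ≤ b) → s ≤ b
  sum≤bound {f} {s} {b} f-sum S≤b = ≮⇒≥ λ b<s →
    let N , near = f-sum (s - b) (x<y⇒0<y-x b<s) in
    <⇒≱ (near N ℕ.≤-refl) (begin
      s - b                     ≤⟨ ≤-by (x≤y⇒0≤y-x (S≤b N))
        (solve 3 (λ s b S → s :- b :+ (b :- S) := :- (S :- s)) refl s b (partialSum f N)) ⟩
      - (partialSum f N - s)    ≤⟨ -x≤∣x∣ _ ⟩
      ∣ partialSum f N - s ∣    ∎)

  -- Convergence along the subsequence `i` suffices because the partial sums increase: from `i k` on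
  -- they are squeezed between `s - rest k` and `s`. The condition `k ≤ i k` puts every partial sum
  -- below one of the subsequence, hence below `s`.
  HasSum-nonNegative : ∀ {f s} → (∀ k → 0# ≤ f k) →
    (i : ℕ → ℕ) → (∀ k → k ℕ.≤ i k) →
    (rest : ℕ → Carrier) → (∀ k → partialSum f (i k) + rest k ≈ s) → (∀ k → 0# ≤ rest k) →
    (∀ ε → 0# < ε → ∃[ k ] rest k < ε) → HasSum f s
  HasSum-nonNegative {f} {s} 0≤f i k≤ik rest sum+rest 0≤rest rest→0 ε 0<ε with rest→0 ε 0<ε
  ... | k , rest<ε = i k , λ n ik≤n → ≤-<-trans (begin
    ∣ partialSum f n - s ∣    ≈⟨ ∣∣-nonPositive (≤-by (x≤y⇒0≤y-x (S≤s n))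
      (solve 2 (λ S s → S :- s :+ (s :- S) := con (+ 0)) refl (partialSum f n) s)) ⟩
    - (partialSum f n - s)    ≤⟨ neg-mono-≤ (+-monoˡ-≤ (- s) (partialSum-mono-≤ 0≤f ik≤n)) ⟩
    - (partialSum f (i k) - s)  ≈⟨ -‿cong (+-congˡ (-‿cong (sum+rest k))) ⟨
    - (partialSum f (i k) - (partialSum f (i k) + rest k))
      ≈⟨ solve 2 (λ S r → :- (S :- (S :+ r)) := r) refl (partialSum f (i k)) (rest k) ⟩
    rest k                    ∎) rest<ε
    where
    S≤s : ∀ n → partialSum f n ≤ s
    S≤s n = ≤-trans (partialSum-mono-≤ 0≤f (k≤ik n)) (≤-by (0≤rest n) (sum+rest n))

-- Detection probabilities and summation over rounds.

module Detection (R : CompleteOrderedField) (p : CompleteOrderedField.Carrier R) where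
  open OrderedField R
  open LinearSearch R

  hit miss : Bool → Carrier
  hit  b = if b then p else 0#
  miss b = if b then 1# - p else 1#

  -- The probability that the first `k` legs bring no detection. The recursion peels off the first
  -- leg, as `firstDetection` does.
  undetected : (ℕ → Bool) → ℕ → Carrier
  undetected passes zero    = 1#
  undetected passes (suc k) = miss (passes 0) * undetected (passes ∘ suc) k

  undetected-snoc : ∀ passes k → undetected passes (suc k) ≈ undetected passes k * miss (passes k)
  undetected-snoc passes zero    = *-comm _ _
  undetected-snoc passes (suc k) =
    trans (*-congˡ (undetected-snoc (passes ∘ suc) k)) (sym (*-assoc _ _ _))

  Pr-∅ : ∀ n → Pr p n (λ _ → false) ≈ 0#
  Pr-∅ zero    = refl
  Pr-∅ (suc n) = trans (+-cong (*-congˡ (Pr-∅ n)) (*-congˡ (Pr-∅ n)))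
    (solve 1 (λ p → p :* con (+ 0) :+ (one :- p) :* con (+ 0) := con (+ 0)) refl p)

  -- Induction on the first trial. If the first leg passes the target, a success rules the event
  -- out, so only the branch of weight `1# - p` survives. If it does not pass, both branches have
  -- the same probability and their weights add up to 1.
  Pr-firstDetection : ∀ passes k →
    Pr p (suc k) (firstDetection passes k) ≈ undetected passes k * hit (passes k)
  Pr-firstDetection passes zero with passes 0
  ... | true  = solve 1 (λ p → p :* one :+ (one :- p) :* con (+ 0) := one :* p) refl p
  ... | false = solve 1 (λ p → p :* con (+ 0) :+ (one :- p) :* con (+ 0) := one :* con (+ 0)) refl p
  Pr-firstDetection passes (suc k) with passes 0 | Pr-firstDetection (passes ∘ suc) k
  ... | true  | ih = trans (+-cong (*-congˡ (Pr-∅ (suc k))) (*-congˡ ih))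
    (solve 3 (λ p u h → p :* con (+ 0) :+ (one :- p) :* (u :* h) := (one :- p) :* u :* h)
      refl p (undetected (passes ∘ suc) k) (hit (passes (suc k))))
  ... | false | ih = trans (+-cong (*-congˡ ih) (*-congˡ ih))
    (solve 3 (λ p u h → p :* (u :* h) :+ (one :- p) :* (u :* h) := one :* u :* h)
      refl p (undetected (passes ∘ suc) k) (hit (passes (suc k))))

  undetected-nonNegative : p ≤ 1# → ∀ passes k → 0# ≤ undetected passes k
  undetected-nonNegative p≤1 passes zero    = 0≤1
  undetected-nonNegative p≤1 passes (suc k) =
    *-nonNegative 0≤miss (undetected-nonNegative p≤1 (passes ∘ suc) k)
    where
    0≤miss : 0# ≤ miss (passes 0)
    0≤miss with passes 0
    ... | true  = x≤y⇒0≤y-x p≤1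
    ... | false = 0≤1

  hit-nonNegative : 0# ≤ p → ∀ b → 0# ≤ hit b
  hit-nonNegative 0≤p true  = 0≤p
  hit-nonNegative 0≤p false = ≤-refl

  RoundPasses : (ℕ → Bool) → Bool → ℕ → Set
  RoundPasses passes b j = passes (j ℕ.* 2) ≡ b × passes (suc (j ℕ.* 2)) ≡ b

  module Rounds (0≤p : 0# ≤ p) (p≤1 : p ≤ 1#) (passes : ℕ → Bool)
                (t : ℕ → Carrier) (0≤t : ∀ k → 0# ≤ t k) where

    q : Carrier
    q = 1# - p

    0≤q : 0# ≤ q
    0≤q = x≤y⇒0≤y-x p≤1

    -- The factor `t` is kept general so that one summation serves twice: the constant 1 gives the
    -- total detection probability, the passing time gives the expectation.
    term : ℕ → Carrier
    term k = undetected passes k * hit (passes k) * t k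

    0≤term : ∀ k → 0# ≤ term k
    0≤term k = *-nonNegative
      (*-nonNegative (undetected-nonNegative p≤1 passes k) (hit-nonNegative 0≤p (passes k))) (0≤t k)

    S U : ℕ → Carrier
    S j = partialSum term (j ℕ.* 2)
    U j = undetected passes (j ℕ.* 2)

    undetected-step : ∀ {b} k → passes k ≡ b →
      undetected passes (suc k) ≈ undetected passes k * miss b
    undetected-step k ≡.refl = undetected-snoc passes k

    term-≈ : ∀ {b} k → passes k ≡ b → term k ≈ undetected passes k * hit b * t k
    term-≈ k ≡.refl = refl

    missed-U : ∀ j → RoundPasses passes false j → U (suc j) ≈ U j
    missed-U j (e₀ , e₁) = trans (undetected-step _ e₁) (trans (*-identityʳ _)
      (trans (undetected-step _ e₀) (*-identityʳ _)))

    missed-S : ∀ j → RoundPasses passes false j → S (suc j) ≈ S j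
    missed-S j (e₀ , e₁) = trans (+-cong (+-congˡ (term-≈ _ e₀)) (term-≈ _ e₁))
      (solve 5 (λ s u t u′ t′ → s :+ u :* con (+ 0) :* t :+ u′ :* con (+ 0) :* t′ := s) refl
        (S j) (U j) (t (j ℕ.* 2)) (undetected passes (suc (j ℕ.* 2))) (t (suc (j ℕ.* 2))))

    passed-U : ∀ j → RoundPasses passes true j → U (suc j) ≈ U j * q * q
    passed-U j (e₀ , e₁) = trans (undetected-step _ e₁) (*-congʳ (undetected-step _ e₀))

    passed-S : ∀ j → RoundPasses passes true j →
      S (suc j) ≈ S j + U j * (p * t (j ℕ.* 2) + q * p * t (suc (j ℕ.* 2)))
    passed-S j (e₀ , e₁) = trans
      (+-cong (+-congˡ (term-≈ _ e₀)) 
        (trans (term-≈ _ e₁) (*-congʳ (*-congʳ (undetected-step _ e₀)))))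
      (solve 6 (λ s u p q t t′ → s :+ u :* p :* t :+ u :* q :* p :* t′
          := s :+ u :* (p :* t :+ q :* p :* t′)) refl
        (S j) (U j) p q (t (j ℕ.* 2)) (t (suc (j ℕ.* 2))))

    -- W k is the expectation of t at the first detection, given no detection
    -- before round k * 2 + m.
    HasSum-alternating : ∀ m → (∀ {j} → j ℕ.< m → RoundPasses passes false j) →
      (∀ k → RoundPasses passes true (k ℕ.* 2 ℕ.+ m)) →
      (∀ k → RoundPasses passes false (suc (k ℕ.* 2 ℕ.+ m))) →
      (W : ℕ → Carrier) → (∀ k → 0# ≤ W k) →
      (∀ k → W k ≈ p * t ((k ℕ.* 2 ℕ.+ m) ℕ.* 2) + q * p * t (suc ((k ℕ.* 2 ℕ.+ m) ℕ.* 2))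
                     + q * q * W (suc k)) →
      (∀ ε → 0# < ε → ∃[ k ] q ^ (k ℕ.* 2) * W k < ε) →
      HasSum term (W 0)
    HasSum-alternating m before at after W 0≤W W-step rest→0 = Series.HasSum-nonNegative R 0≤term
      -- This leg opens the reaching round number `k`, counted from 0.
      (λ k → (k ℕ.* 2 ℕ.+ m) ℕ.* 2)
      (λ k → ℕ.≤-trans (ℕ.m≤m*n k 2) (ℕ.≤-trans (ℕ.m≤m+n (k ℕ.* 2) m) (ℕ.m≤m*n (k ℕ.* 2 ℕ.+ m) 2)))
      (λ k → q ^ (k ℕ.* 2) * W k) sum+rest
      (λ k → *-nonNegative (^-nonNegative 0≤q (k ℕ.* 2)) (0≤W k)) rest→0
      where
      U≈1 : ∀ j → j ℕ.≤ m → U j ≈ 1#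
      U≈1 zero    _   = refl
      U≈1 (suc j) j<m = trans (missed-U j (before j<m)) (U≈1 j (ℕ.<⇒≤ j<m))

      S≈0 : ∀ j → j ℕ.≤ m → S j ≈ 0#
      S≈0 zero    _   = refl
      S≈0 (suc j) j<m = trans (missed-S j (before j<m)) (S≈0 j (ℕ.<⇒≤ j<m))

      U≈q^ : ∀ k → U (k ℕ.* 2 ℕ.+ m) ≈ q ^ (k ℕ.* 2)
      U≈q^ zero    = U≈1 m ℕ.≤-refl
      U≈q^ (suc k) = trans (missed-U (suc (k ℕ.* 2 ℕ.+ m)) (after k))
        (trans (passed-U (k ℕ.* 2 ℕ.+ m) (at k))
        (trans (*-congʳ (*-congʳ (U≈q^ k)))
          (solve 2 (λ x q → x :* q :* q := q :* (q :* x)) refl (q ^ (k ℕ.* 2)) q)))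

      -- An invariant in `k`: `W-step` splits the remainder into the two terms of the reaching round
      -- and the next remainder, and the round in between, on the other side, adds nothing.
      sum+rest : ∀ k → S (k ℕ.* 2 ℕ.+ m) + q ^ (k ℕ.* 2) * W k ≈ W 0
      sum+rest zero    = trans (+-cong (S≈0 m ℕ.≤-refl) (*-identityˡ _)) (+-identityˡ _)
      sum+rest (suc k) = trans
        (+-congʳ (trans (missed-S (suc (k ℕ.* 2 ℕ.+ m)) (after k)) (passed-S (k ℕ.* 2 ℕ.+ m) (at k))))
        (trans (+-congʳ (+-congˡ (*-congʳ (U≈q^ k))))
        (trans (solve 5 (λ s x y q w → s :+ x :* y :+ q :* (q :* x) :* w
                  := s :+ x :* (y :+ q :* q :* w)) refl
                  (S (k ℕ.* 2 ℕ.+ m)) (q ^ (k ℕ.* 2))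
                  (p * t ((k ℕ.* 2 ℕ.+ m) ℕ.* 2) + q * p * t (suc ((k ℕ.* 2 ℕ.+ m) ℕ.* 2)))
                  q (W (suc k)))
        (trans (+-congˡ (*-congˡ (sym (W-step k)))) (sum+rest k))))

-- Constants of the geometric search and the affine recurrence.

module GeometricSearch (R : CompleteOrderedField) (p : CompleteOrderedField.Carrier R)
    (0<p : CompleteOrderedField._<_ R (CompleteOrderedField.0# R) p)
    (p≤1 : CompleteOrderedField._≤_ R p (CompleteOrderedField.1# R)) where
  open OrderedField R
  open LinearSearch R
  open Series R
  open Detection R p

  a b u q : Carrier
  b = fromℕ 2 - p
  a = fromℕ 2 / b
  u = p ⁻¹
  q = 1# - p

  0≤q : 0# ≤ q
  0≤q = x≤y⇒0≤y-x p≤1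

  1≤b : 1# ≤ b
  1≤b = ≤-by 0≤q (solve 1 (λ p → one :+ (one :- p) := con (+ 2) :- p) refl p)

  0≤b : 0# ≤ b
  0≤b = ≤-trans 0≤1 1≤b

  0<b : 0# < b
  0<b = <-≤-trans 0<1 1≤b

  0≤u : 0# ≤ u
  0≤u = proj₁ (⁻¹-positive 0<p)

  ab≈2 : a * b ≈ fromℕ 2
  ab≈2 = /-cancel 0<b

  pu≈1 : p * u ≈ 1#
  pu≈1 = *-inverseʳ p (>⇒≉0 0<p)

  -- Since `p = 2 - b = a b - b`, the assumption `a ≤ 1#` would make `p` nonpositive.
  1<a : 1# < a
  1<a = ≰⇒> λ a≤1 → <⇒≱ 0<p (begin
    p                      ≈⟨ solve 1 (λ p → p := con (+ 2) :- (con (+ 2) :- p)) refl p ⟩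
    fromℕ 2 - b            ≈⟨ +-congʳ ab≈2 ⟨
    a * b - b              ≤⟨ +-monoˡ-≤ (- b) (*-monoʳ-≤ 0≤b a≤1) ⟩
    1# * b - b             ≈⟨ solve 1 (λ b → one :* b :- b := con (+ 0)) refl b ⟩
    0#                     ∎)

  1≤a : 1# ≤ a
  1≤a = proj₁ 1<a

  0≤a : 0# ≤ a
  0≤a = ≤-trans 0≤1 1≤a

  0≤a-1 : 0# ≤ a - 1#
  0≤a-1 = x≤y⇒0≤y-x 1≤a

  1≤a^ : ∀ n → 1# ≤ a ^ n
  1≤a^ = 1≤x^n 1≤a

  0≤a^ : ∀ n → 0# ≤ a ^ n
  0≤a^ = ^-nonNegative 0≤a

  -- The cofactors α and β certify x ≈ y modulo a b ≈ 2 and p u ≈ 1.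
  modulo : ∀ {x y} α β → x ≈ y + (a * b - fromℕ 2) * α + (p * u - 1#) * β → x ≈ y
  modulo {x} {y} α β x≈ = trans x≈ (trans
    (+-cong (+-congˡ (*-congʳ (+-congʳ ab≈2))) (*-congʳ (+-congʳ pu≈1)))
    (solve 3 (λ y α β → y :+ (con (+ 2) :- con (+ 2)) :* α :+ (one :- one) :* β := y) refl y α β))

  -- As `q = b - 1` and `a b = 2`, one has `q a = 2 - a`, so the difference is `a - 1`.
  qa≤1 : q * a ≤ 1#
  qa≤1 = ≤-by 0≤a-1 (modulo 1# 0# (solve 3
    (λ p a u → (one :- p) :* a :+ (a :- one)
      := one :+ (a :* (con (+ 2) :- p) :- con (+ 2)) :* one :+ (p :* u :- one) :* con (+ 0))
    refl p a u))

  -- Here `q a² = (2 - a) a`, so the difference is the square `(a - 1)²`.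
  qaa≤1 : q * a * a ≤ 1#
  qaa≤1 = ≤-by (*-nonNegative 0≤a-1 0≤a-1) (modulo a 0# (solve 3
    (λ p a u → (one :- p) :* a :* a :+ (a :- one) :* (a :- one)
      := one :+ (a :* (con (+ 2) :- p) :- con (+ 2)) :* a :+ (p :* u :- one) :* con (+ 0))
    refl p a u))

  -- The left side is the `k`-th power of `q² a³ = (q a) (q a²)`, a product of two factors in the
  -- unit interval. It shows that `(q a)²ᵏ` decays at least like `1 / aᵏ`.
  damping : ∀ k → a ^ k * (q ^ (k ℕ.* 2) * a ^ (k ℕ.* 2)) ≤ 1#
  damping zero    = ≤-reflexive (solve 0 (one :* (one :* one) := one) refl)
  damping (suc k) = begin
    a * a ^ k * (q * (q * q ^ (k ℕ.* 2)) * (a * (a * a ^ (k ℕ.* 2))))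
      ≈⟨ solve 5 (λ a q x y z → a :* x :* (q :* (q :* y) :* (a :* (a :* z)))
           := q :* a :* (q :* a :* a) :* (x :* (y :* z))) refl
           a q (a ^ k) (q ^ (k ℕ.* 2)) (a ^ (k ℕ.* 2)) ⟩
    q * a * (q * a * a) * (a ^ k * (q ^ (k ℕ.* 2) * a ^ (k ℕ.* 2)))
      ≤⟨ *-mono-≤ 0≤1 0≤rest
           (≤-trans (*-mono-≤ 0≤1 0≤qaa qa≤1 qaa≤1) (≤-reflexive (*-identityˡ 1#)))
           (damping k) ⟩
    1# * 1#
      ≈⟨ *-identityˡ 1# ⟩
    1# ∎
    where
    0≤qaa = *-nonNegative (*-nonNegative 0≤q 0≤a) 0≤a
    0≤rest = *-nonNegative (0≤a^ k) (*-nonNegative (^-nonNegative 0≤q (k ℕ.* 2)) (0≤a^ (k ℕ.* 2)))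

  rest→0 : ∀ (W : ℕ → Carrier) K → (∀ k → W k ≤ a ^ (k ℕ.* 2) * K) → 0# ≤ K →
    ∀ ε → 0# < ε → ∃[ k ] q ^ (k ℕ.* 2) * W k < ε
  rest→0 W K W≤ 0≤K ε 0<ε = let k , K/ε<a^k = ^-unbounded 1<a (K / ε) in
    k , ≰⇒> λ ε≤rest → <⇒≱ K/ε<a^k (*-cancelʳ-≤ 0<ε (begin
    a ^ k * ε                                           ≤⟨ *-monoˡ-≤ (0≤a^ k) ε≤rest ⟩
    a ^ k * (q ^ (k ℕ.* 2) * W k)
      ≤⟨ *-monoˡ-≤ (0≤a^ k) (*-monoˡ-≤ (^-nonNegative 0≤q (k ℕ.* 2)) (W≤ k)) ⟩
    a ^ k * (q ^ (k ℕ.* 2) * (a ^ (k ℕ.* 2) * K))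
      ≈⟨ solve 4 (λ x y z K → x :* (y :* (z :* K)) := x :* (y :* z) :* K) refl
           (a ^ k) (q ^ (k ℕ.* 2)) (a ^ (k ℕ.* 2)) K ⟩
    a ^ k * (q ^ (k ℕ.* 2) * a ^ (k ℕ.* 2)) * K         ≤⟨ *-monoʳ-≤ 0≤K (damping k) ⟩
    1# * K                                              ≈⟨ *-identityˡ K ⟩
    K                                                   ≈⟨ /-cancel 0<ε ⟨
    K / ε * ε                                           ∎))

  -- With A = a ^ j: round j starts at time start A, and if it reaches a target
  -- at distance X that has not been detected before, then the expected
  -- detection time is expected A X.
  start : Carrier → Carrier
  start A = fromℕ 2 * b * u * (A - 1#)

  expected : Carrier → Carrier → Carrier
  expected A X = fromℕ 2 * b * b * u * A + (a - 1#) * X - fromℕ 2 * b * u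

  -- Since `a - 1 = p / b`, the coefficient `b * u` is `1 / (a - 1)`, and `start` at `a ^ j` is
  -- twice the geometric sum of the earlier turning distances.
  start-step : ∀ A → start A + A + A ≈ start (a * A)
  start-step A = sym (modulo (fromℕ 2 * u * A) (fromℕ 2 * A) (solve 4 (λ a p u A →
    let b = con (+ 2) :- p in
    con (+ 2) :* b :* u :* (a :* A :- one)
      := con (+ 2) :* b :* u :* (A :- one) :+ A :+ A
         :+ (a :* b :- con (+ 2)) :* (con (+ 2) :* u :* A) :+ (p :* u :- one) :* (con (+ 2) :* A))
    refl a p u A))

  -- Conditioning on the two passes of the round: detection on the way out, detection on the way
  -- back, or neither, and then the next reaching round turns at `a² A`.
  expected-step : ∀ A X → expected A X ≈
    p * (start A + X) + q * p * (start A + A + (A - X)) + q * q * expected (a * (a * A)) X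
  expected-step A X = modulo
    -- The factor `a * b + fromℕ 2` arises because `a² b²` is replaced by 4, and
    -- `a² b² - 4 = (a b - 2) (a b + 2)`.
    (p * X - fromℕ 2 * q * q * u * A * (a * b + fromℕ 2)) (fromℕ 2 * q * p * A)
    (solve 5 (λ a p u A X →
    let two = con (+ 2); b = two :- p; q = one :- p
        s = two :* b :* u :* (A :- one)
        e = λ A → two :* b :* b :* u :* A :+ (a :- one) :* X :- two :* b :* u
    in e A := p :* (s :+ X) :+ q :* p :* (s :+ A :+ (A :- X)) :+ q :* q :* e (a :* (a :* A))
         :+ (a :* b :- two) :* (p :* X :- two :* q :* q :* u :* A :* (a :* b :+ two))
         :+ (p :* u :- one) :* (two :* q :* p :* A))
    refl a p u A X)

  0≤2bu : 0# ≤ fromℕ 2 * b * u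
  0≤2bu = *-nonNegative (*-nonNegative (fromℕ-nonNegative 2) 0≤b) 0≤u

  0≤2bbu : 0# ≤ fromℕ 2 * b * b * u
  0≤2bbu = *-nonNegative (*-nonNegative (*-nonNegative (fromℕ-nonNegative 2) 0≤b) 0≤b) 0≤u

  expected-nonNegative : ∀ {A X} → 1# ≤ A → 0# ≤ X → 0# ≤ expected A X
  expected-nonNegative {A} {X} 1≤A 0≤X = begin
    0#
      ≤⟨ +-nonNegative (*-nonNegative 0≤2bu (x≤y⇒0≤y-x 1≤bA)) (*-nonNegative 0≤a-1 0≤X) ⟩
    fromℕ 2 * b * u * (b * A - 1#) + (a - 1#) * X
      ≈⟨ solve 5 (λ a b u A X → con (+ 2) :* b :* u :* (b :* A :- one) :+ (a :- one) :* X
           := con (+ 2) :* b :* b :* u :* A :+ (a :- one) :* X :- con (+ 2) :* b :* u)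
           refl a b u A X ⟩
    expected A X ∎
    where
    1≤bA : 1# ≤ b * A
    1≤bA = ≤-trans (≤-reflexive (sym (*-identityˡ 1#))) (*-mono-≤ 0≤b 0≤1 1≤b 1≤A)

  expected≤ : ∀ A X → expected A X ≤ fromℕ 2 * b * b * u * A + (a - 1#) * X
  expected≤ A X = ≤-by 0≤2bu (solve 2 (λ x y → x :- y :+ y := x) refl _ _)

  -- Signs, waypoints and departure times of the trajectory.

  sgn : ℕ → Carrier
  sgn i = (- 1#) ^ suc i

  sgn-suc : ∀ i → sgn (suc i) ≈ - sgn i
  sgn-suc i = solve 1 (λ s → :- one :* s := :- s) refl (sgn i)

  sgn-double : ∀ k i → sgn (k ℕ.* 2 ℕ.+ i) ≈ sgn i
  sgn-double zero    i = refl
  sgn-double (suc k) i = trans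
    (solve 1 (λ s → :- one :* (:- one :* s) := s) refl (sgn (k ℕ.* 2 ℕ.+ i))) (sgn-double k i)

  sgn≈±1 : ∀ i → sgn i ≈ 1# ⊎ sgn i ≈ - 1#
  sgn≈±1 zero    = inj₂ (*-identityʳ _)
  sgn≈±1 (suc i) with sgn≈±1 i
  ... | inj₁ e = inj₂ (trans (sgn-suc i) (-‿cong e))
  ... | inj₂ e = inj₁ (trans (sgn-suc i) (trans (-‿cong e) (solve 0 (:- :- one := one) refl)))

  -- The sign is packaged as a rewriting rule, so that each geometric argument splits only once,
  -- into the right and the left side.
  sgn-cases : ∀ i → (∀ {y z} → y ≈ sgn i * z → y ≈ z) ⊎ (∀ {y z} → y ≈ sgn i * z → y ≈ - z)
  sgn-cases i with sgn≈±1 i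
  ... | inj₁ e = inj₁ λ y≈ → trans y≈ (trans (*-congʳ e) (*-identityˡ _))
  ... | inj₂ e = inj₂ λ y≈ → trans y≈
    (trans (*-congʳ e) (solve 1 (λ z → :- one :* z := :- z) refl _))

  ∣sgn*∣ : ∀ i {z y} → 0# ≤ y → z ≈ sgn i * y → ∣ z ∣ ≈ y
  ∣sgn*∣ i 0≤y z≈ with sgn-cases i
  ... | inj₁ pos = ∣∣-unique 0≤y (inj₁ (pos z≈))
  ... | inj₂ neg = ∣∣-unique 0≤y (inj₂ (neg z≈))

  T : ℕ → Carrier
  T i = sgn i * a ^ i

  w : ℕ → Carrier
  w = rounds T

  rounds-even : ∀ T j → rounds T (j ℕ.* 2) ≡ 0#
  rounds-even T zero    = ≡.refl
  rounds-even T (suc j) = rounds-even (T ∘ suc) j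

  rounds-odd : ∀ T j → rounds T (suc (j ℕ.* 2)) ≡ T j
  rounds-odd T zero    = ≡.refl
  rounds-odd T (suc j) = rounds-odd (T ∘ suc) j

  ∣outward∣ : ∀ j → ∣ w (suc (j ℕ.* 2)) - w (j ℕ.* 2) ∣ ≈ a ^ j
  ∣outward∣ j = ∣sgn*∣ j (0≤a^ j)
    (trans (+-cong (reflexive (rounds-odd T j)) (-‿cong (reflexive (rounds-even T j))))
      (solve 1 (λ x → x :- con (+ 0) := x) refl (T j)))

  ∣inward∣ : ∀ j → ∣ w (suc (suc (j ℕ.* 2))) - w (suc (j ℕ.* 2)) ∣ ≈ a ^ j
  -- The way back runs in the opposite direction, whose sign is that of the next round.
  ∣inward∣ j = ∣sgn*∣ (suc j) (0≤a^ j)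
    (trans (+-cong (reflexive (rounds-even T (suc j))) (-‿cong (reflexive (rounds-odd T j))))
      (solve 2 (λ s y → con (+ 0) :- s :* y := :- one :* s :* y) refl (sgn j) (a ^ j)))

  departure-even : ∀ j → departure w (j ℕ.* 2) ≈ start (a ^ j)
  departure-even zero    = solve 1 (λ c → con (+ 0) := c :* (one :- one)) refl _
  departure-even (suc j) = trans
    (+-cong (+-cong (departure-even j) (∣outward∣ j)) (∣inward∣ j)) (start-step (a ^ j))

  departure-nonNegative : ∀ k → 0# ≤ departure w k
  departure-nonNegative zero    = ≤-refl
  departure-nonNegative (suc k) = +-nonNegative (departure-nonNegative k) (0≤∣x∣ _)

  -- Which legs pass the target.

  Between : Carrier → Carrier → Carrier → Set
  Between y x z = (y ≤ x × x ≤ z) ⊎ (z ≤ x × x ≤ y)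

  -0≤0 : - 0# ≤ 0#
  -0≤0 = ≤-reflexive (solve 0 (:- con (+ 0) := con (+ 0)) refl)

  between : ∀ i {x y X Y} → x ≈ sgn i * X → y ≈ sgn i * Y → 0# ≤ X → X ≤ Y → Between 0# x y
  between i x≈ y≈ 0≤X X≤Y with sgn-cases i
  ... | inj₁ pos = inj₁ (≤-trans 0≤X (≤-reflexive (sym (pos x≈))) ,
      ≤-trans (≤-reflexive (pos x≈)) (≤-trans X≤Y (≤-reflexive (sym (pos y≈)))))
  ... | inj₂ neg = inj₂ (
      ≤-trans (≤-reflexive (neg y≈)) (≤-trans (neg-mono-≤ X≤Y) (≤-reflexive (sym (neg x≈)))) ,
      ≤-trans (≤-reflexive (neg x≈)) (≤-trans (neg-mono-≤ 0≤X) -0≤0))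

  -- The number `Y` may be negative. This is how a round to the other side is excluded: measured
  -- along the target's side, its turning point lies at minus its distance.
  ¬between : ∀ i {x y X Y} → x ≈ sgn i * X → y ≈ sgn i * Y → 0# < X → Y < X → ¬ Between 0# x y
  ¬between i x≈ y≈ 0<X Y<X with sgn-cases i
  ... | inj₁ pos = λ where
      (inj₁ (_ , x≤y)) → <⇒≱ Y<X
        (≤-trans (≤-reflexive (sym (pos x≈))) (≤-trans x≤y (≤-reflexive (pos y≈))))
      (inj₂ (_ , x≤0)) → <⇒≱ 0<X (≤-trans (≤-reflexive (sym (pos x≈))) x≤0)
  ... | inj₂ neg = λ where
      (inj₁ (0≤x , _)) → <⇒≱ 0<X (neg-cancel-≤
        (≤-trans -0≤0 (≤-trans 0≤x (≤-reflexive (neg x≈)))))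
      (inj₂ (y≤x , _)) → <⇒≱ Y<X (neg-cancel-≤
        (≤-trans (≤-reflexive (sym (neg y≈))) (≤-trans y≤x (≤-reflexive (neg x≈)))))

  between⇒∣∣≤ : ∀ {x y} → Between 0# x y → ∣ x ∣ ≤ ∣ y ∣
  between⇒∣∣≤ (inj₁ (0≤x , x≤y)) =
    ≤-trans (≤-reflexive (∣∣-nonNegative 0≤x)) (≤-trans x≤y (x≤∣x∣ _))
  between⇒∣∣≤ (inj₂ (y≤x , x≤0)) =
    ≤-trans (≤-reflexive (∣∣-nonPositive x≤0)) (≤-trans (neg-mono-≤ y≤x) (-x≤∣x∣ _))

  passes : Carrier → ℕ → Bool
  passes x k = ⌊ passes? w x k ⌋

  -- The waypoints do not reduce for a variable `j`, so the types are only propositionally equal;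
  -- `isYes-true` and `isYes-false` transport the decision along this equality.
  outward≡ : ∀ x j → Passes w x (j ℕ.* 2) ≡ Between 0# x (T j)
  outward≡ x j = ≡.cong₂ (λ y z → Between y x z) (rounds-even T j) (rounds-odd T j)

  inward≡ : ∀ x j → Passes w x (suc (j ℕ.* 2)) ≡ Between (T j) x 0#
  inward≡ x j = ≡.cong₂ (λ y z → Between y x z) (rounds-odd T j) (rounds-even T (suc j))

  isYes-true : ∀ {P Q : Set} (P? : Dec P) → P ≡ Q → Q → ⌊ P? ⌋ ≡ true
  isYes-true (yes _) _      _ = ≡.refl
  isYes-true (no ¬p) ≡.refl q = contradiction q ¬p

  isYes-false : ∀ {P Q : Set} (P? : Dec P) → P ≡ Q → ¬ Q → ⌊ P? ⌋ ≡ false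
  isYes-false (no _)  _      _  = ≡.refl
  isYes-false (yes p) ≡.refl ¬q = contradiction p ¬q

  round-passes : ∀ x j → Between 0# x (T j) → RoundPasses (passes x) true j
  round-passes x j B =
    isYes-true (passes? w x (j ℕ.* 2)) (outward≡ x j) B ,
    isYes-true (passes? w x (suc (j ℕ.* 2))) (inward≡ x j) (Sum.swap B)

  round-misses : ∀ x j → ¬ Between 0# x (T j) → RoundPasses (passes x) false j
  round-misses x j ¬B =
    isYes-false (passes? w x (j ℕ.* 2)) (outward≡ x j) ¬B ,
    isYes-false (passes? w x (suc (j ℕ.* 2))) (inward≡ x j) (¬B ∘ Sum.swap)

  -- The first round that reaches the target.

  -- The last component says that the previous round on the same side falls short. Writing it with
  -- `suc (suc i) ≡ m` makes it vacuous for rounds 0 and 1.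
  FirstReach : Carrier → ℕ → Set
  FirstReach x m = x ≈ sgn m * ∣ x ∣ × ∣ x ∣ ≤ a ^ m × (∀ {i} → suc (suc i) ≡ m → a ^ i < ∣ x ∣)

  -- Descent in steps of two from a round known to reach, until the next lower one falls short or
  -- the base round `i` is met.
  firstReach-from : ∀ x i → x ≈ sgn i * ∣ x ∣ → (∀ {j} → suc (suc j) ≡ i → a ^ j < ∣ x ∣) →
    ∀ k → ∣ x ∣ ≤ a ^ (k ℕ.* 2 ℕ.+ i) → ∃[ m ] FirstReach x m
  firstReach-from x i x≈ base zero    reach = i , x≈ , reach , base
  firstReach-from x i x≈ base (suc k) reach with ∣ x ∣ ≤? a ^ (k ℕ.* 2 ℕ.+ i)
  ... | yes reach′ = firstReach-from x i x≈ base k reach′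
  ... | no  ¬reach = suc k ℕ.* 2 ℕ.+ i , trans x≈ (*-congʳ (sym (sgn-double (suc k) i))) , reach ,
    λ where ≡.refl → ≰⇒> ¬reach

  -- Round 0 goes left, so a nonnegative target belongs to the odd rounds, with base 1, and a
  -- negative one to the even rounds, with base 0. The descent starts from a power of `a` beyond the
  -- target.
  firstReach : ∀ x → ∃[ m ] FirstReach x m
  firstReach x = [
      (λ x≈ → firstReach-from x 1
        (trans x≈ (solve 1 (λ y → y := (:- one) :^ 2 :* y) refl ∣ x ∣)) (λ ()) k (within 1)) ,
      (λ x≈- → firstReach-from x 0
        (trans x≈- (solve 1 (λ y → :- y := (:- one) :^ 1 :* y) refl ∣ x ∣)) (λ ()) k (within 0))
    ]′ (∣∣-sign x)
    where
    k = proj₁ (^-unbounded 1<a ∣ x ∣)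
    within : ∀ i → ∣ x ∣ ≤ a ^ (k ℕ.* 2 ℕ.+ i)
    within i = ≤-trans (proj₁ (proj₂ (^-unbounded 1<a ∣ x ∣)))
      (^-monoʳ-≤ 1≤a (ℕ.≤-trans (ℕ.m≤m*n k 2) (ℕ.m≤m+n (k ℕ.* 2) i)))

  -- Expected detection time of a fixed target.

  module Target (x : Carrier) (1≤∣x∣ : 1# ≤ ∣ x ∣) (m : ℕ) (reach : FirstReach x m) where

    X : Carrier
    X = ∣ x ∣

    0≤X : 0# ≤ X
    0≤X = ≤-trans 0≤1 1≤∣x∣

    0<X : 0# < X
    0<X = <-≤-trans 0<1 1≤∣x∣

    x≈ : x ≈ sgn m * X
    x≈ = proj₁ reach

    X≤a^m : X ≤ a ^ m
    X≤a^m = proj₁ (proj₂ reach)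

    opposite : ∀ i j → x ≈ sgn i * X → sgn i ≈ - sgn j → RoundPasses (passes x) false j
    opposite i j x≈i σ = round-misses x j (¬between i x≈i
      (trans (*-congʳ sgnj) (solve 2 (λ s y → :- s :* y := s :* :- y) refl (sgn i) (a ^ j)))
      0<X (≤-<-trans (≤-trans (neg-mono-≤ (0≤a^ j)) -0≤0) 0<X))
      where
      sgnj : sgn j ≈ - sgn i
      sgnj = trans (solve 1 (λ s → s := :- :- s) refl (sgn j)) (-‿cong (sym σ))

    before : ∀ {j} → j ℕ.< m → RoundPasses (passes x) false j
    before {j} j<m = go m j<m x≈ (proj₂ (proj₂ reach))
      where
      go : ∀ m → j ℕ.< m → x ≈ sgn m * X → (∀ {i} → suc (suc i) ≡ m → a ^ i < X) →
           RoundPasses (passes x) false j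
      go (suc m) (s≤s j≤m) x≈ prev with ℕ.m≤n⇒m<n∨m≡n j≤m
      -- The round just before the first reaching one is on the other side.
      ... | inj₂ ≡.refl      = opposite (suc m) m x≈ (sgn-suc m)
      -- All earlier rounds, on either side, turn no farther out than the previous round on the
      -- target's side, which falls short.
      ... | inj₁ (s≤s j≤m-1) = round-misses x j λ B → <⇒≱ (prev ≡.refl)
        (≤-trans (between⇒∣∣≤ B)
          (≤-trans (≤-reflexive (∣sgn*∣ j (0≤a^ j) refl)) (^-monoʳ-≤ 1≤a j≤m-1)))

    x≈sgn : ∀ k → x ≈ sgn (k ℕ.* 2 ℕ.+ m) * X
    x≈sgn k = trans x≈ (*-congʳ (sym (sgn-double k m)))

    X≤a^ : ∀ k → X ≤ a ^ (k ℕ.* 2 ℕ.+ m)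
    X≤a^ k = ≤-trans X≤a^m (^-monoʳ-≤ 1≤a (ℕ.m≤n+m m (k ℕ.* 2)))

    at : ∀ k → RoundPasses (passes x) true (k ℕ.* 2 ℕ.+ m)
    at k = round-passes x (k ℕ.* 2 ℕ.+ m) (between (k ℕ.* 2 ℕ.+ m) (x≈sgn k) refl 0≤X (X≤a^ k))

    after : ∀ k → RoundPasses (passes x) false (suc (k ℕ.* 2 ℕ.+ m))
    after k = opposite (k ℕ.* 2 ℕ.+ m) (suc (k ℕ.* 2 ℕ.+ m)) (x≈sgn k)
      (solve 1 (λ s → s := :- (:- one :* s)) refl _)

    time : ℕ → Carrier
    time = passTime w x

    time-nonNegative : ∀ k → 0# ≤ time k
    time-nonNegative k = +-nonNegative (departure-nonNegative k) (0≤∣x∣ _)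

    time-outward : ∀ j → time (j ℕ.* 2) ≈ start (a ^ j) + X
    time-outward j = +-cong (departure-even j) (∣∣-cong (trans
      (+-congˡ (-‿cong (reflexive (rounds-even T j))))
      (solve 1 (λ x → x :- con (+ 0) := x) refl x)))

    time-inward : ∀ j → x ≈ sgn j * X → X ≤ a ^ j →
      time (suc (j ℕ.* 2)) ≈ start (a ^ j) + a ^ j + (a ^ j - X)
    time-inward j x≈j X≤ = +-cong (+-cong (departure-even j) (∣outward∣ j))
      (∣sgn*∣ (suc j) (x≤y⇒0≤y-x X≤) (trans
        (+-cong x≈j (-‿cong (reflexive (rounds-odd T j))))
        (solve 3 (λ s X A → s :* X :- s :* A := :- one :* s :* (A :- X)) refl (sgn j) X (a ^ j))))

    value : Carrier
    value = expected (a ^ m) X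

    detection : HasSum (detectionProbability p w x) 1#
    detection = HasSum-cong
      (λ k → trans (*-identityʳ _) (sym (Pr-firstDetection (passes x) k)))
      (Rounds.HasSum-alternating (proj₁ 0<p) p≤1 (passes x) (λ _ → 1#) (λ _ → 0≤1)
        m before at after (λ _ → 1#) (λ _ → 0≤1)
        -- With the constant 1 as remainder, the recurrence reads `1 = p + q p + q²`.
        (λ _ → solve 1 (λ p → let q = one :- p in
          one := p :* one :+ q :* p :* one :+ q :* q :* one) refl p)
        (rest→0 (λ _ → 1#) 1#
          (λ k → ≤-trans (1≤a^ (k ℕ.* 2)) (≤-reflexive (sym (*-identityʳ _)))) 0≤1))

    module TimeRounds = Rounds (proj₁ 0<p) p≤1 (passes x) time time-nonNegative

    term≈ : ∀ k → TimeRounds.term k ≈ detectionProbability p w x k * time k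
    term≈ k = *-congʳ (sym (Pr-firstDetection (passes x) k))

    expectation : HasSum (λ k → detectionProbability p w x k * time k) value
    expectation = HasSum-cong term≈
      (TimeRounds.HasSum-alternating m before at after
        (λ k → expected (a ^ (k ℕ.* 2 ℕ.+ m)) X)
        (λ k → expected-nonNegative (1≤a^ (k ℕ.* 2 ℕ.+ m)) 0≤X)
        (λ k → trans (expected-step (a ^ (k ℕ.* 2 ℕ.+ m)) X) (+-congʳ (+-cong
          (*-congˡ (sym (time-outward (k ℕ.* 2 ℕ.+ m))))
          (*-congˡ (sym (time-inward (k ℕ.* 2 ℕ.+ m) (x≈sgn k) (X≤a^ k)))))))
        (rest→0 _ K bound 0≤K))
      where
      -- The expected time at `k = 0` without its negative constant. Going `k` reaching rounds
      -- further multiplies the first summand by `a ^ (k ℕ.* 2)`; the second does not grow, so the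
      -- factor is harmless there.
      K = fromℕ 2 * b * b * u * a ^ m + (a - 1#) * X
      0≤K = +-nonNegative (*-nonNegative 0≤2bbu (0≤a^ m)) (*-nonNegative 0≤a-1 0≤X)
      bound : ∀ k → expected (a ^ (k ℕ.* 2 ℕ.+ m)) X ≤ a ^ (k ℕ.* 2) * K
      bound k = begin
        expected (a ^ (k ℕ.* 2 ℕ.+ m)) X
          ≤⟨ expected≤ _ _ ⟩
        G * a ^ (k ℕ.* 2 ℕ.+ m) + H
          ≤⟨ +-mono-≤ (≤-reflexive (*-congˡ (^-homo-* semiring a (k ℕ.* 2) m)))
               (≤-trans (≤-reflexive (sym (*-identityˡ _)))
                 (*-monoʳ-≤ (*-nonNegative 0≤a-1 0≤X) (1≤a^ (k ℕ.* 2)))) ⟩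
        G * (a ^ (k ℕ.* 2) * a ^ m) + a ^ (k ℕ.* 2) * H
          ≈⟨ solve 4 (λ G y z H → G :* (y :* z) :+ y :* H := y :* (G :* z :+ H)) refl
               G (a ^ (k ℕ.* 2)) (a ^ m) H ⟩
        a ^ (k ℕ.* 2) * K ∎
        where
        G = fromℕ 2 * b * b * u
        H = (a - 1#) * X

    expectedDetectionTime : ExpectedDetectionTime p w x value
    expectedDetectionTime = detection , expectation

    -- The competitive ratio admits every `e` that is a sum of the series, so half of the uniqueness
    -- of limits is called for: the terms are nonnegative, so all partial sums stay below `value`,
    -- and so does `e`.
    expectation≤ : ∀ {e} → ExpectedDetectionTime p w x e → e ≤ value
    expectation≤ (_ , e-sum) = sum≤bound e-sum (partialSum≤sum
      (λ k → ≤-trans (TimeRounds.0≤term k) (≤-reflexive (term≈ k))) expectation)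

    -- From round 2 on, the previous round on this side fell short of `X`. In rounds 0 and 1 the
    -- turning distance is at most `a`, and `1# ≤ X` suffices.
    a^m≤aaX : a ^ m ≤ a * a * X
    a^m≤aaX = go m (proj₂ (proj₂ reach))
      where
      X≤ : ∀ {y} → 1# ≤ y → y ≤ y * X
      X≤ 1≤y = ≤-trans (≤-reflexive (sym (*-identityʳ _))) (*-monoˡ-≤ (≤-trans 0≤1 1≤y) 1≤∣x∣)
      0≤aX = *-nonNegative 0≤a 0≤X
      a≤aaX : a ≤ a * a * X
      a≤aaX = begin
        a            ≤⟨ X≤ 1≤a ⟩
        a * X        ≈⟨ *-identityˡ _ ⟨
        1# * (a * X) ≤⟨ *-monoʳ-≤ 0≤aX 1≤a ⟩
        a * (a * X)  ≈⟨ *-assoc a a X ⟨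
        a * a * X    ∎
      go : ∀ m → (∀ {i} → suc (suc i) ≡ m → a ^ i < X) → a ^ m ≤ a * a * X
      go 0             _    = ≤-trans 1≤a a≤aaX
      go 1             _    = ≤-trans (≤-reflexive (*-identityʳ a)) a≤aaX
      go (suc (suc i)) prev = ≤-trans (≤-reflexive (sym (*-assoc a a (a ^ i))))
        (*-monoˡ-≤ (*-nonNegative 0≤a 0≤a) (proj₁ (prev ≡.refl)))

  -- The ratio as least upper bound.

  ratio : Carrier
  ratio = fromℕ 8 / p + p / b

  p/b≈a-1 : p / b ≈ a - 1#
  p/b≈a-1 = trans
    (solve 2 (λ p v → p :* v := con (+ 2) :* v :- v :* (con (+ 2) :- p)) refl p (b ⁻¹))
    (+-congˡ (-‿cong (*-inverseˡ 0<b)))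

  -- By `a² b² = 4`, the coefficient `2 a² b² u` equals `8 / p`.
  ratio* : ∀ X → ratio * X ≈ fromℕ 2 * b * b * u * (a * a * X) + (a - 1#) * X
  ratio* X = trans (*-congʳ (+-congˡ p/b≈a-1)) (sym (modulo (fromℕ 2 * u * X * (a * b + fromℕ 2)) 0#
    (solve 4 (λ a p u X → let two = con (+ 2); b = two :- p in
      two :* b :* b :* u :* (a :* a :* X) :+ (a :- one) :* X
        := (con (+ 8) :* u :+ (a :- one)) :* X
           :+ (a :* b :- two) :* (two :* u :* X :* (a :* b :+ two)) :+ (p :* u :- one) :* con (+ 0))
      refl a p u X)))

  ratio-upperBound : IsUpperBound _≤_ (CompetitiveRatioAt p w) ratio
  ratio-upperBound r (x , e , 1≤∣x∣ , edt , r≈e/∣x∣) = *-cancelʳ-≤ 0<X (begin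
    r * X                                               ≈⟨ *-congʳ r≈e/∣x∣ ⟩
    e / X * X                                           ≈⟨ /-cancel 0<X ⟩
    e                                                   ≤⟨ expectation≤ edt ⟩
    expected (a ^ m) X                                  ≤⟨ expected≤ _ _ ⟩
    fromℕ 2 * b * b * u * a ^ m + (a - 1#) * X
      ≤⟨ +-monoˡ-≤ _ (*-monoˡ-≤ 0≤2bbu a^m≤aaX) ⟩
    fromℕ 2 * b * b * u * (a * a * X) + (a - 1#) * X    ≈⟨ ratio* X ⟨
    ratio * X                                           ∎)
    where
    m = proj₁ (firstReach x)
    open Target x 1≤∣x∣ m (proj₂ (firstReach x))

  -- Targets just beyond the turning points of the even rounds are the worst.
  module Worst (n : ℕ) (1≤a^n[a-1] : 1# ≤ a ^ n * (a - 1#)) where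

    Y x : Carrier
    Y = a ^ (n ℕ.* 2) + 1#
    x = - Y

    0≤Y : 0# ≤ Y
    0≤Y = +-nonNegative (0≤a^ (n ℕ.* 2)) 0≤1

    ∣x∣≈Y : ∣ x ∣ ≈ Y
    ∣x∣≈Y = ∣∣-unique 0≤Y (inj₂ refl)

    1≤∣x∣ : 1# ≤ ∣ x ∣
    1≤∣x∣ = ≤-trans (≤-by (0≤a^ (n ℕ.* 2)) (+-comm _ _)) (≤-reflexive (sym ∣x∣≈Y))

    n≤n*2 : n ℕ.≤ n ℕ.* 2
    n≤n*2 = ℕ.m≤m*n n 2

    -- The hypothesis on `n` makes the gap between the turning distances `a ^ (n ℕ.* 2)` and
    -- `a ^ suc (n ℕ.* 2)` at least 1, so a target 1 beyond the former is still reached two rounds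
    -- later.
    Y≤aaA : Y ≤ a * (a * a ^ (n ℕ.* 2))
    Y≤aaA = begin
      A + 1#               ≤⟨ +-mono-≤ (≤-refl {A}) (≤-trans 1≤a^n[a-1]
                                (*-monoʳ-≤ 0≤a-1 (^-monoʳ-≤ 1≤a n≤n*2))) ⟩
      A + A * (a - 1#)     ≈⟨ solve 2 (λ A a → A :+ A :* (a :- one) := one :* (a :* A)) refl A a ⟩
      1# * (a * A)         ≤⟨ *-monoʳ-≤ (*-nonNegative 0≤a (0≤a^ (n ℕ.* 2))) 1≤a ⟩
      a * (a * A)          ∎
      where A = a ^ (n ℕ.* 2)

    reach : FirstReach x (suc (suc (n ℕ.* 2)))
    reach = x≈sgn , ≤-trans (≤-reflexive ∣x∣≈Y) Y≤aaA ,
      λ where ≡.refl → <-≤-trans (x<x+1 _) (≤-reflexive (sym ∣x∣≈Y))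
      where
      sgn≈ : sgn (suc n ℕ.* 2) ≈ sgn 0
      sgn≈ = ≡.subst (λ i → sgn i ≈ sgn 0) (ℕ.+-identityʳ (suc n ℕ.* 2)) (sgn-double (suc n) 0)
      x≈sgn : x ≈ sgn (suc (suc (n ℕ.* 2))) * ∣ x ∣
      x≈sgn = sym (trans (*-cong sgn≈ ∣x∣≈Y)
        (solve 1 (λ y → (:- one) :^ 1 :* y := :- y) refl Y))

    -- The shortfall from the claimed ratio, before division by the distance, does not depend on
    -- `n`: it consists of `2 a² b² u` from the extra distance 1 and of the constant term of
    -- `expected`.
    deficit : fromℕ 2 * b * b * u * a * a + fromℕ 2 * b * u
              + expected (a * (a * a ^ (n ℕ.* 2))) ∣ x ∣ ≈ ratio * ∣ x ∣
    deficit = trans (+-congˡ (+-congʳ (+-congˡ (*-congˡ ∣x∣≈Y))))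
      (trans (solve 4 (λ a b u A → let G = con (+ 2) :* b :* b :* u; d = con (+ 2) :* b :* u in
          G :* a :* a :+ d :+ (G :* (a :* (a :* A)) :+ (a :- one) :* (A :+ one) :- d)
            := G :* (a :* a :* (A :+ one)) :+ (a :- one) :* (A :+ one)) refl a b u (a ^ (n ℕ.* 2)))
      (trans (sym (ratio* Y)) (*-congˡ (sym ∣x∣≈Y))))

    open Target x 1≤∣x∣ (suc (suc (n ℕ.* 2))) reach using (0<X; value; expectedDetectionTime)

    -- A bound `c` below `ratio` would thus confine the unbounded distances `Y` by a fixed constant.
    Y-bound : ∀ c → IsUpperBound _≤_ (CompetitiveRatioAt p w) c →
              Y * (ratio - c) ≤ fromℕ 2 * b * b * u * a * a + fromℕ 2 * b * u
    Y-bound c bound = begin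
      Y * (ratio - c)                    ≈⟨ *-congʳ ∣x∣≈Y ⟨
      ∣ x ∣ * (ratio - c)
        ≈⟨ solve 3 (λ X r c → X :* (r :- c) := r :* X :- c :* X) refl ∣ x ∣ ratio c ⟩
      ratio * ∣ x ∣ - c * ∣ x ∣          ≈⟨ +-congʳ deficit ⟨
      D + value - c * ∣ x ∣              ≤⟨ ≤-by (x≤y⇒0≤y-x value≤)
        (solve 3 (λ D v y → D :+ v :- y :+ (y :- v) := D) refl D value (c * ∣ x ∣)) ⟩
      D                                  ∎
      where
      D = fromℕ 2 * b * b * u * a * a + fromℕ 2 * b * u
      value≤ : value ≤ c * ∣ x ∣
      value≤ = ≤-trans (≤-reflexive (sym (/-cancel 0<X)))
        (*-monoʳ-≤ (proj₁ 0<X) (bound _ (x , value , 1≤∣x∣ , expectedDetectionTime , refl)))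

  ratio-least : ∀ c → IsUpperBound _≤_ (CompetitiveRatioAt p w) c → ratio ≤ c
  ratio-least c bound = ≮⇒≥ λ c<ratio →
    let 0<gap = x<y⇒0<y-x c<ratio
        -- The first summand is the largest distance that `Y-bound` permits; the second secures the
        -- hypothesis of `Worst` on `n`.
        n , M<a^n = ^-unbounded 1<a (D / (ratio - c) + 1# / (a - 1#))
    in <⇒≱ M<a^n (a^n≤M n 0<gap (proj₁ M<a^n))
    where
    D = fromℕ 2 * b * b * u * a * a + fromℕ 2 * b * u
    0<a-1 = x<y⇒0<y-x 1<a
    0≤D : 0# ≤ D
    0≤D = +-nonNegative (*-nonNegative (*-nonNegative 0≤2bbu 0≤a) 0≤a) 0≤2bu
    a^n≤M : ∀ n → 0# < ratio - c → D / (ratio - c) + 1# / (a - 1#) ≤ a ^ n →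
             a ^ n ≤ D / (ratio - c) + 1# / (a - 1#)
    a^n≤M n 0<gap M≤a^n = begin
      a ^ n                                ≤⟨ ^-monoʳ-≤ 1≤a n≤n*2 ⟩
      a ^ (n ℕ.* 2)                        ≤⟨ proj₁ (x<x+1 _) ⟩
      Y                                    ≤⟨ *-cancelʳ-≤ 0<gap
        (≤-trans (Y-bound c bound) (≤-reflexive (sym (/-cancel 0<gap)))) ⟩
      D / (ratio - c)                      ≤⟨ ≤-by (/-nonNegative 0≤1 0<a-1) refl ⟩
      D / (ratio - c) + 1# / (a - 1#)      ∎
      where
      1/[a-1]≤a^n : 1# / (a - 1#) ≤ a ^ n
      1/[a-1]≤a^n = ≤-trans (≤-by (/-nonNegative 0≤D 0<gap) (+-comm _ _)) M≤a^n
      open Worst n (≤-trans (≤-reflexive (sym (/-cancel 0<a-1)))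
        (*-monoʳ-≤ (proj₁ 0<a-1) 1/[a-1]≤a^n))

theorem1 : (R : CompleteOrderedField) →
    let open CompleteOrderedField R
        open LinearSearch R
    in (p : Carrier) → 0# < p → p ≤ 1# →
       let a = fromℕ 2 / (fromℕ 2 - p)
       in IsExpectedCompetitiveRatio p
            (rounds (λ i → (- 1#) ^ suc i * a ^ i))
            (fromℕ 8 / p + p / (fromℕ 2 - p))
theorem1 R p 0<p p≤1 =
    (λ x 1≤∣x∣ → let m , reach = firstReach x
                     open Target x 1≤∣x∣ m reach
                 in value , expectedDetectionTime)
  , ratio-upperBound , ratio-least
  where open GeometricSearch R p 0<p p≤1
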